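{- The algorithm $\textsc{SolveSafeReach}(V,F)$ (defined in the context) solves weak games with $n$ nodes, $k$ accepting nodes and $l$ strongly connected components in symbolic time $\mathcal{O}(n+kl)\subseteq\mathcal{O}(n^2)$, and yields memoryless winning strategies for the system player. That is, on every weak game $((V,E),F)$ with $|V|=n$, $|F|=k$ and $l$ SCCs, the algorithm terminates after $\mathcal{O}(n+kl)$ symbolic operations, returns exactly the set of nodes won by the system player, and yields a memoryless system strategy that wins from every node of this set.
   Context: **Games.** A game arena is a finite directed graph $A=(V,E)$ in which every node has a successor, with $V$ partitioned into system nodes $V_s$ and environment nodes $V_e$; $E(v)$ is the set of successors of $v$. A memoryless system strategy is a map $\sigma:V_s\to V$ with $\sigma(v)\in E(v)$. In a Büchi game $(A,F)$, $F\subseteq V$, the system player wins an infinite play iff it visits $F$ infinitely often. A strategy wins node $v$ if all plays from $v$ compatible with it are won by its owner; every node is won by exactly one player. **Weak games.** A deterministic weak automaton (DWA) $(T,F_T)$ consists of a deterministic transition system $T=(2^{AP},Q,\iota,\delta)$ ($AP$ finite, $Q$ finite, $\delta:Q\times 2^{AP}\to Q$) and $F_T\subseteq Q$ such that every strongly connected component (SCC: maximal set of mutually reachable states) is contained in or disjoint from $F_T$. With $AP=X\uplus Y$, it induces the arena with nodes $Q\cup(Q\times 2^X)\cup(Q\times 2^X\times 2^Y)$, $V_s=Q$, all other nodes in $V_e$, and edges $q\to(q,x)$, $(q,x)\to(q,x,y)$, $(q,x,y)\to\delta(q,x\cup y)$ for all $x\subseteq X,y\subseteq Y$. A weak game (DWA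 game) is a Büchi game $(A,F)$ induced in this way by a DWA, where a node belongs to $F$ iff its $Q$-component is in $F_T$. Hence every SCC of $A$ is contained in $F$ or disjoint from $F$. **Symbolic operations.** For $W\subseteq V$ put $\Diamond W=\{v\mid E(v)\cap W\ne\emptyset\}$, $\Box W=\{v\mid E(v)\subseteq W\}$, and $\mathsf{CPre}_s(W)=(V_s\cap\Diamond W)\cup(V_e\cap\Box W)$. Symbolic time counts the number of set operations (union, intersection, complement) on subsets of $V$; evaluating $\mathsf{CPre}_s$ costs $\mathcal{O}(1)$. Define, with $\mu$ and $\nu$ denoting least and greatest fixpoints over $2^V$ (computed by iteration from $\emptyset$ and $V$ respectively), $$\mathrm{Reach}(W,T)=\mu Z.\,T\cup(W\cap\mathsf{CPre}_s(Z)),\qquad \mathrm{Safe}(W,T)=\nu Z.\,T\cup(W\cap\mathsf{CPre}_s(Z)).$$ **Algorithm $\textsc{SolveSafeReach}(V,F)$.** Initialize $i=0$, $W_0=\emptyset$, $W_{ -2}=V$. While $W_{2i}\neq W_{2(i-1)}$: set $W_{2i+1}=\mathrm{Safe}(F,W_{2i})$, then $W_{2i+2}=\mathrm{Reach}(V,W_{2i+1})$, then $i=i+1$. Return $W_{2i}$. -}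

module Defs where

open import Data.Fin.Base using (Fin)
open import Data.Fin.Subset
open import Data.Fin.Subset.Properties using (nonempty?; _⊆?_)
open import Data.List.Base using (List; length; applyUpTo)
import Data.List.Membership.Propositional as List
open import Data.List.Relation.Unary.Unique.Propositional using (Unique)
open import Data.Nat.Base using (ℕ; suc; _+_; _≤_)
open import Data.Product.Base using (∃-syntax; _×_)
open import Data.Sum.Base using (_⊎_)
open import Data.Vec.Base using (tabulate; _++_)
open import Function.Bundles using (_⇔_; _↔_; Inverse)
open import Relation.Binary.Core using (Rel)
open import Relation.Binary.Construct.Closure.ReflexiveTransitive using (Star)
open import Relation.Binary.PropositionalEquality.Core using (_≡_; _≢_)
open import Relation.Nullary.Decidable.Core using (does)
open import Level using (0ℓ)

------------------------------------------------------------------------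
-- Strongly connected components of a graph on Fin n

module _ {n : ℕ} (_⟶_ : Rel (Fin n) 0ℓ) where

  MutuallyReachable : Subset n → Set
  MutuallyReachable S = ∀ {u v} → u ∈ S → v ∈ S → Star _⟶_ u v

  -- A node on no cycle forms an SCC by itself.
  IsSCC : Subset n → Set
  IsSCC S = MutuallyReachable S ×
            (∀ S′ → S ⊆ S′ → MutuallyReachable S′ → S′ ⊆ S)

  HasSCCs : ℕ → Set
  HasSCCs l = ∃[ sccs ] Unique sccs × length sccs ≡ l ×
              (∀ S → S List.∈ sccs ⇔ IsSCC S)

------------------------------------------------------------------------
-- Games

record Arena : Set where
  field
    size   : ℕ
    E      : Fin size → Subset size
    serial : ∀ v → Nonempty (E v)
    Vₛ     : Subset size

  V : Set
  V = Fin size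

  Vₑ : Subset size
  Vₑ = ∁ Vₛ

  _⟶_ : Rel V 0ℓ
  u ⟶ v = v ∈ E u

record BüchiGame : Set where
  field
    arena : Arena
  open Arena arena public
  field
    F : Subset size

module _ (G : BüchiGame) where
  open BüchiGame G

  -- The list is the play so far, oldest node first, without the current node.
  record Strategy : Set where
    field
      move  : List V → (v : V) → v ∈ Vₛ → V
      legal : ∀ h v (s : v ∈ Vₛ) → move h v s ∈ E v

  record MemorylessStrategy : Set where
    field
      move  : (v : V) → v ∈ Vₛ → V
      legal : ∀ v (s : v ∈ Vₛ) → move v s ∈ E v

  IsPlayFrom : V → (ℕ → V) → Set
  IsPlayFrom v π = π 0 ≡ v × (∀ i → π i ⟶ π (suc i))

  Compatible : Strategy → (ℕ → V) → Set
  Compatible σ π = ∀ i (s : π i ∈ Vₛ) →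
    π (suc i) ≡ Strategy.move σ (applyUpTo π i) (π i) s

  SystemWinsPlay : (ℕ → V) → Set
  SystemWinsPlay π = ∀ i → ∃[ j ] i ≤ j × π j ∈ F

  WinsFrom : Strategy → V → Set
  WinsFrom σ v = ∀ π → IsPlayFrom v π → Compatible σ π → SystemWinsPlay π

  WonBySystem : V → Set
  WonBySystem v = ∃[ σ ] WinsFrom σ v

module _ {G : BüchiGame} where

  forgetful : MemorylessStrategy G → Strategy G
  forgetful σ = record
    { move  = λ _ → MemorylessStrategy.move σ
    ; legal = λ _ → MemorylessStrategy.legal σ
    }

------------------------------------------------------------------------
-- Deterministic weak automata and weak games

-- AP is Fin (inputs + outputs), with X the first and Y the last block of
-- propositions; for x ⊆ X and y ⊆ Y the letter x ∪ y is x ++ y.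
record DWA : Set where
  field
    ∣X∣ ∣Y∣ ∣Q∣ : ℕ
    ι           : Fin ∣Q∣
    δ           : Fin ∣Q∣ → Subset (∣X∣ + ∣Y∣) → Fin ∣Q∣
    Fₜ          : Subset ∣Q∣

  Q : Set
  Q = Fin ∣Q∣

  _⇝_ : Rel Q 0ℓ
  p ⇝ q = ∃[ a ] δ p a ≡ q

  field
    weak : ∀ S → IsSCC _⇝_ S → S ⊆ Fₜ ⊎ Empty (S ∩ Fₜ)

  data Node : Set where
    ⟨_⟩     : Q → Node
    ⟨_,_⟩   : Q → Subset ∣X∣ → Node
    ⟨_,_,_⟩ : Q → Subset ∣X∣ → Subset ∣Y∣ → Node

  component : Node → Q
  component ⟨ q ⟩         = q
  component ⟨ q , x ⟩     = q
  component ⟨ q , x , y ⟩ = q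

  data Edge : Rel Node 0ℓ where
    choose-x : ∀ {q} x → Edge ⟨ q ⟩ ⟨ q , x ⟩
    choose-y : ∀ {q x} y → Edge ⟨ q , x ⟩ ⟨ q , x , y ⟩
    proceed  : ∀ {q x y} → Edge ⟨ q , x , y ⟩ ⟨ δ q (x ++ y) ⟩

-- The nodes of a game are numbered, so a game is induced by a DWA relative
-- to a numbering of the nodes.
record Induces (D : DWA) (G : BüchiGame) : Set where
  open DWA D
  open BüchiGame G
  field
    numbering : V ↔ Node

  node : V → Node
  node = Inverse.to numbering

  field
    edges     : ∀ u v → u ⟶ v ⇔ Edge (node u) (node v)
    system    : ∀ v → v ∈ Vₛ ⇔ (∃[ q ] node v ≡ ⟨ q ⟩)
    accepting : ∀ v → v ∈ F ⇔ component (node v) ∈ Fₜ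

record WeakGame : Set where
  field
    dwa     : DWA
    game    : BüchiGame
    induced : Induces dwa game
  open BüchiGame game public

------------------------------------------------------------------------
-- Symbolic operations and the algorithm

module Fixpoints {n : ℕ} (f : Subset n → Subset n) where

  IsLeastFixpoint : Subset n → Set
  IsLeastFixpoint R = f R ≡ R × (∀ Z → f Z ≡ Z → R ⊆ Z)

  IsGreatestFixpoint : Subset n → Set
  IsGreatestFixpoint R = f R ≡ R × (∀ Z → f Z ≡ Z → Z ⊆ R)

  -- Iterates c Z R t: iterating f from Z until it becomes stationary
  -- terminates with R in time t, when one evaluation of f takes time c.
  data Iterates (c : ℕ) : (Z R : Subset n) (t : ℕ) → Set where
    stop : ∀ {Z} → f Z ≡ Z → Iterates c Z Z c
    step : ∀ {Z R t} → f Z ≢ Z → Iterates c (f Z) R t →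
           Iterates c Z R (c + t)

-- Runs are inductive, so that a run exists exactly if the computation
-- terminates.  The parameter κ is the constant cost of evaluating CPreₛ.
-- As symbolic time counts set operations only, comparisons are free.
module SymbolicAlgorithm (G : BüchiGame) (κ : ℕ) where
  open BüchiGame G
  open Fixpoints

  ◇ □ CPreₛ : Subset size → Subset size
  ◇ W = tabulate λ v → does (nonempty? (E v ∩ W))
  □ W = tabulate λ v → does (E v ⊆? W)
  CPreₛ W = (Vₛ ∩ ◇ W) ∪ (Vₑ ∩ □ W)

  body : (W T Z : Subset size) → Subset size
  body W T Z = T ∪ (W ∩ CPreₛ Z)

  -- One union, one intersection and one application of CPreₛ.
  bodyCost : ℕ
  bodyCost = 2 + κ

  Reach : (W T R : Subset size) (t : ℕ) → Set
  Reach W T R t = IsLeastFixpoint (body W T) R ×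
                  Iterates (body W T) bodyCost ⊥ R t

  Safe : (W T R : Subset size) (t : ℕ) → Set
  Safe W T R t = IsGreatestFixpoint (body W T) R ×
                 Iterates (body W T) bodyCost ⊤ R t

  -- Loop W₂₍ᵢ₋₁₎ W₂ᵢ R t: the while loop, entered with the given values,
  -- terminates in time t and returns R.
  data Loop : (W₋ W R : Subset size) (t : ℕ) → Set where
    exit  : ∀ {W₋ W} → W ≡ W₋ → Loop W₋ W W 0
    round : ∀ {W₋ W S W₊ R t₁ t₂ t₃} → W ≢ W₋ →
            Safe F W S t₁ → Reach ⊤ S W₊ t₂ → Loop W W₊ R t₃ →
            Loop W₋ W R (t₁ + t₂ + t₃)

  SolveSafeReach : (R : Subset size) (t : ℕ) → Set
  SolveSafeReach = Loop ⊤ ⊥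

{-# OPTIONS --safe #-}
-- Every set W computed by the algorithm is built up in layers: a node enters a
-- layer because it is forced into the preceding one, or because it is accepting
-- and forced into the current one.  Descending through the layers is a
-- memoryless strategy that wins on W.  If W is a fixpoint of a round, then
-- outside W the environment can, against any strategy, stay outside W and leave
-- F infinitely often; in a weak game such a play visits F only finitely often,
-- since a node visited twice around a visit to ∁ F would share its SCC with a
-- non-accepting node.
--
-- For the running time, let the rank of a node be the number of SCCs reachable
-- from it.  It never increases along an edge, and it decreases along every edge
-- leaving F; hence round i collects all nodes of rank below i that are ever
-- collected, and O(l) rounds suffice.  A greatest fixpoint needs at most ∣F∣ + 2
-- evaluations, as only accepting nodes can be removed after the first one, and
-- the costs of the least fixpoints telescope because their sets keep growing.
module Submission where

open import Defs
open import Data.Bool.Base using (true; if_then_else_)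
open import Data.Fin.Base as Fin using (Fin)
import Data.Fin.Properties as Fin
open import Data.Fin.Subset
open import Data.Fin.Subset.Properties
open import Data.List.Base using (List; []; _∷_; _∷ʳ_; length; filter; lookup; applyUpTo)
open import Data.List.Properties using (applyUpTo-∷ʳ; length-filter)
import Data.List.Membership.Propositional as List
open import Data.List.Membership.Propositional.Properties using (∈-lookup)
open import Data.List.Relation.Unary.All as All using (All)
open import Data.List.Relation.Unary.AllPairs using (_∷_)
open import Data.List.Relation.Unary.Any using (here; there)
open import Data.List.Relation.Unary.Unique.Propositional using (Unique)
open import Data.List.Relation.Binary.Sublist.Propositional.Properties
  using (length-mono-≤; filter⁺)
open import Data.List.Relation.Binary.Sublist.Propositional using () renaming (⊆-refl to ⊑-refl)
open import Data.Nat.Base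
open import Data.Nat.Induction using (Acc; acc; <-wellFounded)
open import Data.Nat.Properties
open import Data.Nat.Tactic.RingSolver using (solve-∀)
open import Data.Product.Base using (∃-syntax; _×_; _,_; proj₁; proj₂)
open import Data.Sum.Base using (_⊎_; inj₁; inj₂; [_,_]′)
open import Data.Vec.Base using (tabulate; []; _∷_)
open import Data.Vec.Properties using (≡-dec; lookup∘tabulate; []=⇒lookup; lookup⇒[]=)
open import Data.Vec.Properties.WithK using ([]=-irrelevant)
import Data.Bool.Properties as Bool
open import Effect.Monad using (RawMonad)
open import Function.Base using (_∘_; id)
open import Function.Bundles using (_⇔_; Equivalence; Inverse; mk⇔)
open import Level using (0ℓ)
open import Relation.Binary.Construct.Closure.ReflexiveTransitive
  using (Star; ε; _◅_; _◅◅_; kleisliStar)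
open import Relation.Binary.Core using (Rel)
open import Relation.Binary.Definitions using (DecidableEquality)
open import Relation.Binary.PropositionalEquality
open import Relation.Nullary.Decidable
  using (Dec; yes; no; does; dec-true; dec-false; decidable-stable; _×-dec_; ¬¬-excluded-middle)
open import Relation.Nullary.Negation using (¬_; contradiction; ¬¬-Monad; ¬¬-map)
open import Relation.Unary using (Pred; Decidable)

open Equivalence using (to; from)

private
  variable
    n : ℕ

-- Finite subsets and lists

_≟ˢ_ : DecidableEquality (Subset n)
_≟ˢ_ = ≡-dec Bool._≟_

does⇒ : {A : Set} (A? : Dec A) → does A? ≡ true → A
does⇒ (yes a) _ = a

∈-tabulate⇔ : {P : Fin n → Set} (P? : ∀ i → Dec (P i)) {i : Fin n} →
  i ∈ tabulate (λ i → does (P? i)) ⇔ P i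
∈-tabulate⇔ P? {i} = mk⇔
  (λ i∈ → does⇒ (P? i) (trans (sym (lookup∘tabulate _ i)) ([]=⇒lookup i∈)))
  (λ p → lookup⇒[]= i _ (trans (lookup∘tabulate _ i) (dec-true (P? i) p)))

⊈⇒∃∉ : (p q : Subset n) → p ⊈ q → ∃[ x ] x ∈ p × x ∉ q
⊈⇒∃∉ p q p⊈q with nonempty? (p ∩ ∁ q)
... | yes (x , x∈) with x∈p , x∈∁q ← x∈p∩q⁻ p (∁ q) x∈ = x , x∈p , x∈∁p⇒x∉p x∈∁q
... | no ¬∃ = contradiction (λ {x} x∈p → x∉∁p⇒x∈p (λ x∈∁q → ¬∃ (x , x∈p∩q⁺ (x∈p , x∈∁q)))) p⊈q

⊆∧≢⇒⊂ : {p q : Subset n} → p ⊆ q → p ≢ q → p ⊂ q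
⊆∧≢⇒⊂ {p = p} {q} p⊆q p≢q = p⊆q , ⊈⇒∃∉ q p (λ q⊆p → p≢q (⊆-antisym p⊆q q⊆p))

∣p∪q∣≤∣p∣+∣q∣ : (p q : Subset n) → ∣ p ∪ q ∣ ≤ ∣ p ∣ + ∣ q ∣
∣p∪q∣≤∣p∣+∣q∣ [] [] = z≤n
∣p∪q∣≤∣p∣+∣q∣ (outside ∷ p) (outside ∷ q) = ∣p∪q∣≤∣p∣+∣q∣ p q
∣p∪q∣≤∣p∣+∣q∣ (outside ∷ p) (inside ∷ q) rewrite +-suc ∣ p ∣ ∣ q ∣ = s≤s (∣p∪q∣≤∣p∣+∣q∣ p q)
∣p∪q∣≤∣p∣+∣q∣ (inside ∷ p) (outside ∷ q) = s≤s (∣p∪q∣≤∣p∣+∣q∣ p q)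
∣p∪q∣≤∣p∣+∣q∣ (inside ∷ p) (inside ∷ q) rewrite +-suc ∣ p ∣ ∣ q ∣ = s≤s (m≤n⇒m≤1+n (∣p∪q∣≤∣p∣+∣q∣ p q))

length-filter-< : {A : Set} {P Q : Pred A 0ℓ} (P? : Decidable P) (Q? : Decidable Q) →
  (∀ {x} → P x → Q x) → ∀ {x xs} → x List.∈ xs → Q x → ¬ P x →
  length (filter P? xs) < length (filter Q? xs)
length-filter-< P? Q? P⊆Q {x} {x ∷ xs} (here refl) qx ¬px with P? x | Q? x
... | yes px | _ = contradiction px ¬px
... | no _ | no ¬qx = contradiction qx ¬qx
... | no _ | yes _ = s≤s (length-mono-≤ (filter⁺ P? Q? (λ { refl → P⊆Q }) (⊑-refl {x = xs})))
length-filter-< P? Q? P⊆Q {x} {y ∷ xs} (there x∈) qx ¬px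
  with ih ← length-filter-< P? Q? P⊆Q x∈ qx ¬px | P? y | Q? y
... | yes py | no ¬qy = contradiction (P⊆Q py) ¬qy
... | yes _ | yes _ = s≤s ih
... | no _ | yes _ = m≤n⇒m≤1+n ih
... | no _ | no _ = ih

unique-lookup-injective : {A : Set} {xs : List A} → Unique xs →
  ∀ i j → lookup xs i ≡ lookup xs j → i ≡ j
unique-lookup-injective (x∉ ∷ u) Fin.zero Fin.zero eq = refl
unique-lookup-injective (x∉ ∷ u) Fin.zero (Fin.suc j) eq = contradiction eq (All.lookup x∉ (∈-lookup j))
unique-lookup-injective (x∉ ∷ u) (Fin.suc i) Fin.zero eq = contradiction (sym eq) (All.lookup x∉ (∈-lookup i))
unique-lookup-injective (x∉ ∷ u) (Fin.suc i) (Fin.suc j) eq = cong Fin.suc (unique-lookup-injective u i j eq)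

-- Reachability and strongly connected components

module _ {_⟶_ : Rel (Fin n) 0ℓ} where

  -- The relation is arbitrary, so reachability is decided only under a double negation, by finitely
  -- many instances of excluded middle. This suffices wherever the goal is itself decidable.
  ¬¬-reachable? : ¬ ¬ (∀ u v → Dec (Star _⟶_ u v))
  ¬¬-reachable? = sequence λ _ → sequence λ _ → ¬¬-excluded-middle
    where
    sequence : ∀ {m} {P : Fin m → Set} → (∀ i → ¬ ¬ P i) → ¬ ¬ (∀ i → P i)
    sequence = Fin.sequence (RawMonad.rawApplicative ¬¬-Monad)

  scc : (∀ u v → Dec (Star _⟶_ u v)) → Fin n → Subset n
  scc reach? v = tabulate λ w → does (reach? v w ×-dec reach? w v)

  module _ (reach? : ∀ u v → Dec (Star _⟶_ u v)) where

    ∈-scc : ∀ {v w} → w ∈ scc reach? v ⇔ (Star _⟶_ v w × Star _⟶_ w v)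
    ∈-scc {v} = ∈-tabulate⇔ (λ w → reach? v w ×-dec reach? w v)

    scc-isSCC : ∀ v → IsSCC _⟶_ (scc reach? v)
    scc-isSCC v =
      (λ u∈ w∈ → proj₂ (to ∈-scc u∈) ◅◅ proj₁ (to ∈-scc w∈)) ,
      λ S ⊆S mut w∈S → let v∈S = ⊆S (from ∈-scc (ε , ε)) in
        from ∈-scc (mut v∈S w∈S , mut w∈S v∈S)

  IsSCC⇒Nonempty : Fin n → ∀ {S} → IsSCC _⟶_ S → Nonempty S
  IsSCC⇒Nonempty v {S} (_ , maximal) with nonempty? S
  ... | yes ne = ne
  ... | no ¬ne = contradiction
    (v , maximal ⁅ v ⁆ (λ x∈S → contradiction (_ , x∈S) ¬ne)
      (λ x∈ y∈ → subst₂ (Star _⟶_) (sym (x∈⁅y⁆⇒x≡y v x∈)) (sym (x∈⁅y⁆⇒x≡y v y∈)) ε)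
      (x∈⁅x⁆ v))
    ¬ne

  -- Paths through the shared node `v` make `S ∪ T` mutually reachable, so the maximality of `T`
  -- absorbs `S`.
  SCC-⊆ : ∀ {S T v} → IsSCC _⟶_ S → IsSCC _⟶_ T → v ∈ S → v ∈ T → S ⊆ T
  SCC-⊆ {S} {T} {v} (mutS , _) (mutT , maxT) v∈S v∈T =
    ⊆-trans (p⊆p∪q {p = S} T) (maxT (S ∪ T) (q⊆p∪q S T) λ x∈ y∈ → proj₂ (via x∈) ◅◅ proj₁ (via y∈))
    where
    via : ∀ {x} → x ∈ S ∪ T → Star _⟶_ v x × Star _⟶_ x v
    via x∈ with x∈p∪q⁻ S T x∈
    ... | inj₁ x∈S = mutS v∈S x∈S , mutS x∈S v∈S
    ... | inj₂ x∈T = mutT v∈T x∈T , mutT x∈T v∈T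

  -- Distinct SCCs are disjoint, so choosing a node from each is injective. The given node rules out
  -- the empty graph, whose only SCC is `⊥`.
  #SCCs≤n : Fin n → ∀ {l} → HasSCCs _⟶_ l → l ≤ n
  #SCCs≤n v₀ (sccs , unique , refl , complete) = Fin.injective⇒≤ {f = rep} rep-injective
    where
    isSCC : ∀ i → IsSCC _⟶_ (lookup sccs i)
    isSCC i = to (complete _) (∈-lookup i)
    rep : Fin (length sccs) → Fin n
    rep i = proj₁ (IsSCC⇒Nonempty v₀ (isSCC i))
    rep∈ : ∀ i → rep i ∈ lookup sccs i
    rep∈ i = proj₂ (IsSCC⇒Nonempty v₀ (isSCC i))
    rep-injective : ∀ {i j} → rep i ≡ rep j → i ≡ j
    rep-injective {i} {j} eq = unique-lookup-injective unique i j (⊆-antisym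
      (SCC-⊆ (isSCC i) (isSCC j) (rep∈ i) (subst (_∈ lookup sccs j) (sym eq) (rep∈ j)))
      (SCC-⊆ (isSCC j) (isSCC i) (rep∈ j) (subst (_∈ lookup sccs i) eq (rep∈ i))))

-- Fixpoint iteration and its cost

module _ {f : Subset n → Subset n} where
  open Fixpoints f

  iterates-induction : ∀ {c Z R t} (P : Subset n → Set) → (∀ {Y} → P Y → P (f Y)) →
    Iterates c Z R t → P Z → P R
  iterates-induction P P-step (stop _) pz = pz
  iterates-induction P P-step (step _ it) pz = iterates-induction P P-step it (P-step pz)

  iterates-fixpoint : ∀ {c Z R t} → Iterates c Z R t → f R ≡ R
  iterates-fixpoint (stop eq) = eq
  iterates-fixpoint (step _ it) = iterates-fixpoint it

  -- A potential argument: each evaluation costs `c`, and each but the last lowers `μ`. The unspent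
  -- potential `c * μ R` stays on the left so that bounds for consecutive iterations telescope.
  iterates-terminates : (μ : Subset n → ℕ) (I : Subset n → Set) →
    (∀ {Z} → I Z → I (f Z)) → (∀ {Z} → I Z → f Z ≢ Z → μ (f Z) < μ Z) →
    ∀ c Z → I Z → ∃[ R ] ∃[ t ] Iterates c Z R t × t + c * μ R ≤ c * suc (μ Z)
  iterates-terminates μ I I-step decreases c Z i = go Z i (<-wellFounded (μ Z))
    where
    open ≤-Reasoning hiding (stop)
    go : ∀ Z → I Z → Acc _<_ (μ Z) → ∃[ R ] ∃[ t ] Iterates c Z R t × t + c * μ R ≤ c * suc (μ Z)
    go Z i (acc rs) with f Z ≟ˢ Z
    ... | yes eq = Z , c , stop eq , ≤-reflexive (sym (*-suc c (μ Z)))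
    ... | no neq with R , t , it , bound ← go (f Z) (I-step i) (rs (decreases i neq)) =
      R , c + t , step neq it , (begin
        c + t + c * μ R        ≡⟨ +-assoc c t _ ⟩
        c + (t + c * μ R)      ≤⟨ +-monoʳ-≤ c bound ⟩
        c + c * suc (μ (f Z))  ≤⟨ +-monoʳ-≤ c (*-monoʳ-≤ c (decreases i neq)) ⟩
        c + c * μ Z            ≡⟨ sym (*-suc c (μ Z)) ⟩
        c * suc (μ Z)          ∎)

  module _ (f-mono : ∀ {Y Z} → Y ⊆ Z → f Y ⊆ f Z) where

    iterate-up : ∀ c Z → Z ⊆ f Z →
      ∃[ R ] ∃[ t ] Iterates c Z R t × t + c * ∣ ∁ R ∣ ≤ c * suc ∣ ∁ Z ∣
    iterate-up = iterates-terminates (λ Z → ∣ ∁ Z ∣) (λ Z → Z ⊆ f Z) f-mono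
      (λ Z⊆fZ fZ≢Z → p⊂q⇒∣p∣<∣q∣ (p⊂q⇒∁p⊃∁q (⊆∧≢⇒⊂ Z⊆fZ (fZ≢Z ∘ sym))))

    iterate-down : ∀ c Z → f Z ⊆ Z →
      ∃[ R ] ∃[ t ] Iterates c Z R t × t + c * ∣ R ∣ ≤ c * suc ∣ Z ∣
    iterate-down = iterates-terminates ∣_∣ (λ Z → f Z ⊆ Z) f-mono
      (λ fZ⊆Z fZ≢Z → p⊂q⇒∣p∣<∣q∣ (⊆∧≢⇒⊂ fZ⊆Z fZ≢Z))

    iterates-least : ∀ {c R t} → Iterates c ⊥ R t → IsLeastFixpoint R
    iterates-least it = iterates-fixpoint it ,
      λ Z fZ≡Z → iterates-induction (_⊆ Z)
        (λ Y⊆Z → subst (f _ ⊆_) fZ≡Z (f-mono Y⊆Z)) it (⊆-min Z)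

    iterates-greatest : ∀ {c R t} → Iterates c ⊤ R t → IsGreatestFixpoint R
    iterates-greatest it = iterates-fixpoint it ,
      λ Z fZ≡Z → iterates-induction (Z ⊆_)
        (λ Z⊆Y → subst (_⊆ f _) fZ≡Z (f-mono Z⊆Y)) it (⊆-max Z)

module Game (G : BüchiGame) (κ : ℕ) where
  open BüchiGame G
  open SymbolicAlgorithm G κ
  open Fixpoints

  private
    c = bodyCost

  -- Controllable predecessors

  Forces : V → Subset size → Set
  Forces v A = (v ∈ Vₛ × ∃[ u ] u ∈ E v × u ∈ A) ⊎ (v ∉ Vₛ × E v ⊆ A)

  CPreₛ⇔ : ∀ {A v} → v ∈ CPreₛ A ⇔ Forces v A
  CPreₛ⇔ {A} {v} = mk⇔ ⇒ ⇐
    where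
    ⇒ : v ∈ CPreₛ A → Forces v A
    ⇒ v∈ with x∈p∪q⁻ (Vₛ ∩ ◇ A) (Vₑ ∩ □ A) v∈
    ... | inj₁ v∈₁ with s , v∈◇ ← x∈p∩q⁻ Vₛ (◇ A) v∈₁
                   with u , u∈ ← to (∈-tabulate⇔ (λ v → nonempty? (E v ∩ A))) v∈◇ =
      inj₁ (s , u , x∈p∩q⁻ (E v) A u∈)
    ... | inj₂ v∈₂ with e , v∈□ ← x∈p∩q⁻ Vₑ (□ A) v∈₂ =
      inj₂ (x∈∁p⇒x∉p e , to (∈-tabulate⇔ {P = λ v → E v ⊆ A} (λ v → E v ⊆? A)) v∈□)
    ⇐ : Forces v A → v ∈ CPreₛ A
    ⇐ (inj₁ (s , u , u∈)) = x∈p∪q⁺ (inj₁ (x∈p∩q⁺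
      (s , from (∈-tabulate⇔ (λ v → nonempty? (E v ∩ A))) (u , x∈p∩q⁺ u∈))))
    ⇐ (inj₂ (¬s , Ev⊆A)) = x∈p∪q⁺ (inj₂ (x∈p∩q⁺
      (x∉p⇒x∈∁p ¬s , from (∈-tabulate⇔ {P = λ v → E v ⊆ A} (λ v → E v ⊆? A)) Ev⊆A)))

  -- Sharper than monotonicity: only successors of `v` have to pass from `A` to `B`, so facts about
  -- the edges leaving `v` can be used.
  CPreₛ-map : ∀ {A B v} → (∀ {u} → u ∈ E v → u ∈ A → u ∈ B) → v ∈ CPreₛ A → v ∈ CPreₛ B
  CPreₛ-map A⇒B v∈ with to CPreₛ⇔ v∈
  ... | inj₁ (s , u , u∈E , u∈A) = from CPreₛ⇔ (inj₁ (s , u , u∈E , A⇒B u∈E u∈A))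
  ... | inj₂ (¬s , Ev⊆A) = from CPreₛ⇔ (inj₂ (¬s , λ u∈E → A⇒B u∈E (Ev⊆A u∈E)))

  CPreₛ-mono : ∀ {A B} → A ⊆ B → CPreₛ A ⊆ CPreₛ B
  CPreₛ-mono A⊆B = CPreₛ-map (λ _ → A⊆B)

  ∉CPreₛ-system : ∀ {A v} → v ∉ CPreₛ A → v ∈ Vₛ → ∀ {u} → u ∈ E v → u ∉ A
  ∉CPreₛ-system v∉ s u∈E u∈A = v∉ (from CPreₛ⇔ (inj₁ (s , _ , u∈E , u∈A)))

  ∉CPreₛ-environment : ∀ {A v} → v ∉ CPreₛ A → v ∉ Vₛ → ∃[ u ] u ∈ E v × u ∉ A
  ∉CPreₛ-environment {A} {v} v∉ ¬s =
    ⊈⇒∃∉ (E v) A (λ Ev⊆A → v∉ (from CPreₛ⇔ (inj₂ (¬s , λ {_} → Ev⊆A))))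

  body⇔ : ∀ {W T Z v} → v ∈ body W T Z ⇔ (v ∈ T ⊎ (v ∈ W × v ∈ CPreₛ Z))
  body⇔ {W} {T} {Z} = mk⇔
    (λ v∈ → [ inj₁ , (λ v∈′ → inj₂ (x∈p∩q⁻ W (CPreₛ Z) v∈′)) ]′ (x∈p∪q⁻ T (W ∩ CPreₛ Z) v∈))
    [ (λ v∈T → x∈p∪q⁺ (inj₁ v∈T)) , (λ v∈′ → x∈p∪q⁺ (inj₂ (x∈p∩q⁺ v∈′))) ]′

  body-mono : ∀ {W T Y Z} → Y ⊆ Z → body W T Y ⊆ body W T Z
  body-mono {W} {T} {Y} {Z} Y⊆Z v∈ with to (body⇔ {W} {T} {Y}) v∈
  ... | inj₁ v∈T = from (body⇔ {W} {T} {Z}) (inj₁ v∈T)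
  ... | inj₂ (v∈W , v∈C) = from (body⇔ {W} {T} {Z}) (inj₂ (v∈W , CPreₛ-mono Y⊆Z v∈C))

  -- Running time of a round and of the loop

  abstract
    -- The first evaluation leaves only nodes of `W ∪ F`, and those of `W` are never removed. So at
    -- most `∣ F ∣` further evaluations shrink the set, and a last one detects stationarity.
    safe-terminates : ∀ W → ∃[ S ] ∃[ t ] Iterates (body F W) c ⊤ S t × t ≤ c * (2 + ∣ F ∣)
    safe-terminates W with body F W ⊤ ≟ˢ ⊤
    ... | yes eq = ⊤ , c , stop eq , m≤m*n c (2 + ∣ F ∣)
    ... | no neq with S , t , it , bound ← iterate-down body-mono c (body F W ⊤) (body-mono {F} {W} (⊆-max _)) =
      -- Adding `c * ∣ W ∣` on both sides avoids a subtraction; on the left it is at most the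
      -- unspent `c * ∣ S ∣`.
      S , c + t , step neq it , +-cancelʳ-≤ (c * ∣ W ∣) _ _ (begin
        c + t + c * ∣ W ∣                  ≤⟨ +-monoʳ-≤ (c + t) (*-monoʳ-≤ c (p⊆q⇒∣p∣≤∣q∣ W⊆S)) ⟩
        c + t + c * ∣ S ∣                  ≡⟨ +-assoc c t _ ⟩
        c + (t + c * ∣ S ∣)                ≤⟨ +-monoʳ-≤ c bound ⟩
        c + c * suc ∣ body F W ⊤ ∣         ≤⟨ +-monoʳ-≤ c (*-monoʳ-≤ c (s≤s body-size)) ⟩
        c + c * suc (∣ W ∣ + ∣ F ∣)        ≡⟨ rearrange c ∣ W ∣ ∣ F ∣ ⟩
        c * (2 + ∣ F ∣) + c * ∣ W ∣        ∎)
      where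
      open ≤-Reasoning hiding (stop)
      rearrange : ∀ c w k → c + c * suc (w + k) ≡ c * (2 + k) + c * w
      rearrange = solve-∀
      body-size : ∣ body F W ⊤ ∣ ≤ ∣ W ∣ + ∣ F ∣
      body-size = ≤-trans (∣p∪q∣≤∣p∣+∣q∣ W _) (+-monoʳ-≤ ∣ W ∣ (∣p∩q∣≤∣p∣ F (CPreₛ ⊤)))
      W⊆S : W ⊆ S
      W⊆S {v} v∈W = subst (v ∈_) (iterates-fixpoint it) (from (body⇔ {F} {W} {S}) (inj₁ v∈W))

    -- The first evaluation already yields all of `S`, so afterwards only nodes of `∁ S` can be
    -- added. The term `c * ∣ ∁ R ∣` charges the evaluations to the nodes gained.
    reach-terminates : ∀ S → ∃[ R ] ∃[ t ] Iterates (body ⊤ S) c ⊥ R t ×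
      t + c * ∣ ∁ R ∣ ≤ c * (2 + ∣ ∁ S ∣)
    reach-terminates S with body ⊤ S ⊥ ≟ˢ ⊥
    ... | yes eq = ⊥ , c , stop eq , (begin
        c + c * ∣ ∁ (⊥ {size}) ∣          ≡⟨ sym (*-suc c ∣ ∁ (⊥ {size}) ∣) ⟩
        c * suc ∣ ∁ (⊥ {size}) ∣          ≤⟨ *-monoʳ-≤ c (s≤s (p⊆q⇒∣p∣≤∣q∣ (p⊆q⇒∁p⊇∁q (λ {_} → S⊆⊥)))) ⟩
        c * suc ∣ ∁ S ∣          ≤⟨ *-monoʳ-≤ c (n≤1+n (suc ∣ ∁ S ∣)) ⟩
        c * (2 + ∣ ∁ S ∣)        ∎)
      where
      open ≤-Reasoning hiding (stop)
      S⊆⊥ : S ⊆ ⊥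
      S⊆⊥ {v} v∈S = subst (v ∈_) eq (from (body⇔ {⊤} {S} {⊥}) (inj₁ v∈S))
    ... | no neq with R , t , it , bound ← iterate-up body-mono c (body ⊤ S ⊥) (body-mono {⊤} {S} (⊆-min _)) =
      R , c + t , step neq it , (begin
        c + t + c * ∣ ∁ R ∣             ≡⟨ +-assoc c t _ ⟩
        c + (t + c * ∣ ∁ R ∣)           ≤⟨ +-monoʳ-≤ c bound ⟩
        c + c * suc ∣ ∁ (body ⊤ S ⊥) ∣  ≡⟨ sym (*-suc c (suc ∣ ∁ (body ⊤ S ⊥) ∣)) ⟩
        c * (2 + ∣ ∁ (body ⊤ S ⊥) ∣)    ≤⟨ *-monoʳ-≤ c (s≤s (s≤s (p⊆q⇒∣p∣≤∣q∣ (p⊆q⇒∁p⊇∁q {p = S} (p⊆p∪q _))))) ⟩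
        c * (2 + ∣ ∁ S ∣)               ∎)
      where open ≤-Reasoning hiding (stop)

  safe reach next : Subset size → Subset size
  safe W = proj₁ (safe-terminates W)
  reach S = proj₁ (reach-terminates S)
  next W = reach (safe W)

  safe-iterates : ∀ W → Iterates (body F W) c ⊤ (safe W) _
  safe-iterates W = proj₁ (proj₂ (proj₂ (safe-terminates W)))

  reach-iterates : ∀ S → Iterates (body ⊤ S) c ⊥ (reach S) _
  reach-iterates S = proj₁ (proj₂ (proj₂ (reach-terminates S)))

  safe⇔ : ∀ {W v} → v ∈ safe W ⇔ (v ∈ W ⊎ (v ∈ F × v ∈ CPreₛ (safe W)))
  safe⇔ {W} {v} = mk⇔
    (λ v∈ → to (body⇔ {F} {W}) (subst (v ∈_) (sym (iterates-fixpoint (safe-iterates W))) v∈))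
    (λ v∈ → subst (v ∈_) (iterates-fixpoint (safe-iterates W)) (from (body⇔ {F} {W}) v∈))

  ∈-reach : ∀ {S v} → v ∈ S ⊎ v ∈ CPreₛ (reach S) → v ∈ reach S
  ∈-reach {S} {v} v∈ = subst (v ∈_) (iterates-fixpoint (reach-iterates S))
    (from (body⇔ {⊤} {S}) ([ inj₁ , (λ v∈C → inj₂ (∈⊤ , v∈C)) ]′ v∈))

  safe⊆next : ∀ {W} → safe W ⊆ next W
  safe⊆next = ∈-reach ∘ inj₁

  ⊆next : ∀ {W} → W ⊆ next W
  ⊆next v∈W = safe⊆next (from safe⇔ (inj₁ v∈W))

  round-time : ∀ W → ∃[ t₁ ] ∃[ t₂ ] Safe F W (safe W) t₁ × Reach ⊤ (safe W) (next W) t₂ ×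
    t₁ + t₂ + c * ∣ ∁ (next W) ∣ ≤ c * (4 + ∣ F ∣ + ∣ ∁ W ∣)
  round-time W = t₁ , t₂ ,
    (iterates-greatest body-mono (safe-iterates W) , safe-iterates W) ,
    (iterates-least body-mono (reach-iterates (safe W)) , reach-iterates (safe W)) , (begin
      t₁ + t₂ + c * ∣ ∁ (next W) ∣                   ≡⟨ +-assoc t₁ t₂ _ ⟩
      t₁ + (t₂ + c * ∣ ∁ (next W) ∣)                 ≤⟨ +-mono-≤ bound₁ bound₂ ⟩
      c * (2 + ∣ F ∣) + c * (2 + ∣ ∁ (safe W) ∣)     ≤⟨ +-monoʳ-≤ (c * (2 + ∣ F ∣)) (*-monoʳ-≤ c (+-monoʳ-≤ 2 ∁safe≤∁)) ⟩
      c * (2 + ∣ F ∣) + c * (2 + ∣ ∁ W ∣)            ≡⟨ rearrange c ∣ F ∣ ∣ ∁ W ∣ ⟩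
      c * (4 + ∣ F ∣ + ∣ ∁ W ∣)                      ∎)
    where
    open ≤-Reasoning hiding (stop)
    t₁ = proj₁ (proj₂ (safe-terminates W))
    t₂ = proj₁ (proj₂ (reach-terminates (safe W)))
    bound₁ = proj₂ (proj₂ (proj₂ (safe-terminates W)))
    bound₂ = proj₂ (proj₂ (proj₂ (reach-terminates (safe W))))
    ∁safe≤∁ : ∣ ∁ (safe W) ∣ ≤ ∣ ∁ W ∣
    ∁safe≤∁ = p⊆q⇒∣p∣≤∣q∣ (p⊆q⇒∁p⊇∁q {p = W} (from safe⇔ ∘ inj₁))
    rearrange : ∀ c k w → c * (2 + k) + c * (2 + w) ≡ c * (4 + k + w)
    rearrange = solve-∀

  -- approx i is the set W₂ᵢ of the algorithm.
  approx : ℕ → Subset size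
  approx zero = ⊥
  approx (suc i) = next (approx i)

  private
    rearrange₁ : ∀ t c j x → t + c * (j + x) ≡ t + c * x + c * j
    rearrange₁ = solve-∀
    rearrange₂ : ∀ c k y j → c * (k + y) + c * j ≡ c * (k + j + y)
    rearrange₂ = solve-∀

  -- Here `j` bounds the remaining rounds. Each is charged `4 + ∣ F ∣` evaluations, and the rest
  -- telescopes along the growing sets. The exit test also makes the returned set a fixpoint of
  -- `next`.
  loop-terminates : ∀ i j → approx (suc (i + j)) ≡ approx (i + j) →
    ∃[ m ] ∃[ t ] Loop (approx i) (approx (suc i)) (approx m) t × next (approx m) ≡ approx m ×
      t + c * ∣ ∁ (approx m) ∣ ≤ c * (j * (4 + ∣ F ∣) + ∣ ∁ (approx (suc i)) ∣)
  loop-terminates i j stationary with approx (suc i) ≟ˢ approx i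
  ... | yes eq = suc i , 0 , exit eq , cong next eq , *-monoʳ-≤ c (m≤n+m _ (j * (4 + ∣ F ∣)))
  loop-terminates i zero stationary | no neq =
    contradiction (subst (λ m → approx (suc m) ≡ approx m) (+-identityʳ i) stationary) neq
  loop-terminates i (suc j) stationary | no neq
    with t₁ , t₂ , run₁ , run₂ , bound ← round-time (approx (suc i))
    with m , t₃ , run₃ , fixed , bound′ ← loop-terminates (suc i) j
      (subst (λ m → approx (suc m) ≡ approx m) (+-suc i j) stationary) =
    m , t₁ + t₂ + t₃ , round neq run₁ run₂ run₃ , fixed , (begin
      t₁ + t₂ + t₃ + c * ∣ ∁ (approx m) ∣        ≡⟨ +-assoc (t₁ + t₂) t₃ _ ⟩
      t₁ + t₂ + (t₃ + c * ∣ ∁ (approx m) ∣)      ≤⟨ +-monoʳ-≤ (t₁ + t₂) bound′ ⟩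
      t₁ + t₂ + c * (j * (4 + ∣ F ∣) + x)        ≡⟨ rearrange₁ (t₁ + t₂) c (j * (4 + ∣ F ∣)) x ⟩
      t₁ + t₂ + c * x + c * (j * (4 + ∣ F ∣))    ≤⟨ +-monoˡ-≤ _ bound ⟩
      c * (4 + ∣ F ∣ + ∣ ∁ (approx (suc i)) ∣) + c * (j * (4 + ∣ F ∣))
                                                 ≡⟨ rearrange₂ c (4 + ∣ F ∣) ∣ ∁ (approx (suc i)) ∣ (j * (4 + ∣ F ∣)) ⟩
      c * (suc j * (4 + ∣ F ∣) + ∣ ∁ (approx (suc i)) ∣) ∎)
    where
    open ≤-Reasoning hiding (stop)
    x = ∣ ∁ (approx (2+ i)) ∣

  -- The first round is split off, since the initial `W₋` is `⊤` and not a preceding member of the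
  -- sequence `approx`. The given node ensures `⊥ ≢ ⊤`, so the loop is entered.
  algorithm-terminates : V → ∀ j → approx (suc j) ≡ approx j →
    ∃[ m ] ∃[ t ] SolveSafeReach (approx m) t × next (approx m) ≡ approx m ×
      t ≤ c * (suc j * (4 + ∣ F ∣) + size)
  algorithm-terminates v₀ j stationary
    with t₁ , t₂ , run₁ , run₂ , bound ← round-time ⊥
    with m , t₃ , run₃ , fixed , bound′ ← loop-terminates 0 j stationary =
    m , t₁ + t₂ + t₃ , round ⊥≢⊤ run₁ run₂ run₃ , fixed , (begin
      t₁ + t₂ + t₃                               ≤⟨ +-monoʳ-≤ (t₁ + t₂) (≤-trans (m≤m+n t₃ _) bound′) ⟩
      t₁ + t₂ + c * (j * (4 + ∣ F ∣) + x)        ≡⟨ rearrange₁ (t₁ + t₂) c (j * (4 + ∣ F ∣)) x ⟩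
      t₁ + t₂ + c * x + c * (j * (4 + ∣ F ∣))    ≤⟨ +-monoˡ-≤ _ bound ⟩
      c * (4 + ∣ F ∣ + ∣ ∁ (⊥ {size}) ∣) + c * (j * (4 + ∣ F ∣))
                                                 ≡⟨ rearrange₂ c (4 + ∣ F ∣) ∣ ∁ (approx 0) ∣ (j * (4 + ∣ F ∣)) ⟩
      c * (suc j * (4 + ∣ F ∣) + ∣ ∁ (⊥ {size}) ∣)        ≤⟨ *-monoʳ-≤ c (+-monoʳ-≤ (suc j * (4 + ∣ F ∣)) (∣p∣≤n (∁ (⊥ {size})))) ⟩
      c * (suc j * (4 + ∣ F ∣) + size)           ∎)
    where
    open ≤-Reasoning hiding (stop)
    x = ∣ ∁ (approx 1) ∣
    ⊥≢⊤ : ⊥ {size} ≢ ⊤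
    ⊥≢⊤ eq = ∉⊥ (subst (v₀ ∈_) (sym eq) ∈⊤)

  -- Layered sets and the memoryless winning strategy

  data Layered : Subset size → Set where
    base  : Layered ⊥
    -- One constructor serves both stages: a safe set uses the second case, which refers to `U′`
    -- itself because a play may stay there forever; each iterate of a reach set uses the third.
    layer : ∀ {U U′} → Layered U → U ⊆ U′ →
      (∀ {v} → v ∈ U′ → v ∈ U ⊎ (v ∈ F × v ∈ CPreₛ U′) ⊎ v ∈ CPreₛ U) → Layered U′

  Layered-safe : ∀ {W} → Layered W → Layered (safe W)
  Layered-safe L = layer L (from safe⇔ ∘ inj₁) (λ v∈ → [ inj₁ , inj₂ ∘ inj₁ ]′ (to safe⇔ v∈))

  Layered-reach : ∀ {S} → Layered S → Layered (reach S)
  Layered-reach {S} L = subst Layered (⊆-antisym ⊆₁ (q⊆p∪q S (reach S)))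
    -- The union with `S` lets the layering start at `S` although the iteration starts at `⊥`; the
    -- second component records that the iterates grow.
    (proj₁ (iterates-induction (λ Z → Layered (S ∪ Z) × Z ⊆ body ⊤ S Z) extend (reach-iterates S)
      (subst Layered (sym (∪-identityʳ S)) L , ⊆-min _)))
    where
    ⊆₁ : S ∪ reach S ⊆ reach S
    ⊆₁ v∈ = [ ∈-reach ∘ inj₁ , id ]′ (x∈p∪q⁻ S (reach S) v∈)
    extend : ∀ {Z} → Layered (S ∪ Z) × Z ⊆ body ⊤ S Z → Layered (S ∪ body ⊤ S Z) × body ⊤ S Z ⊆ body ⊤ S (body ⊤ S Z)
    extend {Z} (L′ , Z⊆) = layer L′ ⊆₂ enter , body-mono {⊤} {S} Z⊆
      where
      ⊆₂ : S ∪ Z ⊆ S ∪ body ⊤ S Z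
      ⊆₂ v∈ = x∈p∪q⁺ ([ inj₁ , inj₂ ∘ Z⊆ ]′ (x∈p∪q⁻ S Z v∈))
      enter : ∀ {v} → v ∈ S ∪ body ⊤ S Z → v ∈ S ∪ Z ⊎ (v ∈ F × v ∈ CPreₛ (S ∪ body ⊤ S Z)) ⊎ v ∈ CPreₛ (S ∪ Z)
      enter v∈ with x∈p∪q⁻ S (body ⊤ S Z) v∈
      ... | inj₁ v∈S = inj₁ (x∈p∪q⁺ (inj₁ v∈S))
      ... | inj₂ v∈b with to (body⇔ {⊤} {S} {Z}) v∈b
      ...   | inj₁ v∈S = inj₁ (x∈p∪q⁺ (inj₁ v∈S))
      ...   | inj₂ (_ , v∈C) = inj₂ (inj₂ (CPreₛ-mono (q⊆p∪q S Z) v∈C))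

  Layered-approx : ∀ i → Layered (approx i)
  Layered-approx zero = base
  Layered-approx (suc i) = Layered-reach (Layered-safe (Layered-approx i))

  Layered-closed : ∀ {U} → Layered U → U ⊆ CPreₛ U
  Layered-closed base v∈ = contradiction v∈ ∉⊥
  Layered-closed (layer L U⊆U′ enter) v∈ with enter v∈
  ... | inj₁ v∈U = CPreₛ-mono U⊆U′ (Layered-closed L v∈U)
  ... | inj₂ (inj₁ (_ , v∈C)) = v∈C
  ... | inj₂ (inj₂ v∈C) = CPreₛ-mono U⊆U′ v∈C

  stepInto : Subset size → ∀ v → Nonempty (E v)
  stepInto A v with nonempty? (E v ∩ A)
  ... | yes (u , u∈) = u , proj₁ (x∈p∩q⁻ (E v) A u∈)
  ... | no _ = serial v

  stepInto-∈ : ∀ {A v} → v ∈ Vₛ → v ∈ CPreₛ A → proj₁ (stepInto A v) ∈ A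
  stepInto-∈ {A} {v} s v∈C with nonempty? (E v ∩ A) | to CPreₛ⇔ v∈C
  ... | yes (_ , u∈) | _ = proj₂ (x∈p∩q⁻ (E v) A u∈)
  ... | no ¬∃ | inj₁ (_ , u , u∈E , u∈A) = contradiction (u , x∈p∩q⁺ (u∈E , u∈A)) ¬∃
  ... | no _ | inj₂ (¬s , _) = contradiction s ¬s

  -- A node keeps the move of the first layer containing it. Descending into `U` has priority, so
  -- among the nodes of `U′` only accepting ones get to the last case.
  move : ∀ {U} → Layered U → ∀ v → Nonempty (E v)
  move base v = serial v
  move (layer {U} {U′} L _ _) v =
    if does (v ∈? U) then move L v
    else if does (v ∈? CPreₛ U) then stepInto U v
    else stepInto U′ v

  layeredStrategy : ∀ {U} → Layered U → MemorylessStrategy G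
  layeredStrategy L = record
    { move  = λ v _ → proj₁ (move L v)
    ; legal = λ v _ → proj₂ (move L v)
    }

  module _ {π : ℕ → V} (edges : ∀ i → π i ⟶ π (suc i)) where

    -- Demanded on `U` only, so that it passes to lower layers, where `move` makes the same choice.
    Consistent : ∀ {U} → Layered U → Set
    Consistent {U} L = ∀ i → π i ∈ U → π i ∈ Vₛ → π (suc i) ≡ proj₁ (move L (π i))

    enters : ∀ {A} i → π i ∈ CPreₛ A → (π i ∈ Vₛ → π (suc i) ≡ proj₁ (stepInto A (π i))) → π (suc i) ∈ A
    enters {A} i ∈C moves with to CPreₛ⇔ ∈C
    ... | inj₁ (s , _) = subst (_∈ A) (sym (moves s)) (stepInto-∈ s ∈C)
    ... | inj₂ (_ , E⊆A) = E⊆A (edges i)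

    module _ {U U′} (L : Layered U) (U⊆U′ : U ⊆ U′)
      (enter : ∀ {v} → v ∈ U′ → v ∈ U ⊎ (v ∈ F × v ∈ CPreₛ U′) ⊎ v ∈ CPreₛ U)
      (consistent : Consistent (layer L U⊆U′ enter)) where

      consistent-below : Consistent L
      consistent-below i ∈U s with eq ← consistent i (U⊆U′ ∈U) s
        rewrite dec-true (π i ∈? U) ∈U = eq

      advance : ∀ i → π i ∈ U′ → π i ∈ U ⊎ π (suc i) ∈ U ⊎ (π i ∈ F × π (suc i) ∈ U′)
      advance i ∈U′ with π i ∈? U
      ... | yes ∈U = inj₁ ∈U
      ... | no ∉U with π i ∈? CPreₛ U
      ...   | yes ∈C = inj₂ (inj₁ (enters i ∈C moves))
        where
        moves : π i ∈ Vₛ → π (suc i) ≡ proj₁ (stepInto U (π i))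
        moves s with eq ← consistent i ∈U′ s
          rewrite dec-false (π i ∈? U) ∉U | dec-true (π i ∈? CPreₛ U) ∈C = eq
      ...   | no ∉C with enter ∈U′
      ...     | inj₁ ∈U = contradiction ∈U ∉U
      ...     | inj₂ (inj₂ ∈C) = contradiction ∈C ∉C
      ...     | inj₂ (inj₁ (∈F , ∈C′)) = inj₂ (inj₂ (∈F , enters i ∈C′ moves))
        where
        moves : π i ∈ Vₛ → π (suc i) ≡ proj₁ (stepInto U′ (π i))
        moves s with eq ← consistent i ∈U′ s
          rewrite dec-false (π i ∈? U) ∉U | dec-false (π i ∈? CPreₛ U) ∉C = eq

    stays : ∀ {U} (L : Layered U) → Consistent L → ∀ i → π i ∈ U → π (suc i) ∈ U
    stays base _ i ∈⊥ = contradiction ∈⊥ ∉⊥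
    stays (layer L U⊆U′ enter) con i ∈U′ with advance L U⊆U′ enter con i ∈U′
    ... | inj₁ ∈U = U⊆U′ (stays L (consistent-below L U⊆U′ enter con) i ∈U)
    ... | inj₂ (inj₁ ∈U) = U⊆U′ ∈U
    ... | inj₂ (inj₂ (_ , ∈U′₊)) = ∈U′₊

    -- Induction over the layers: by `advance` the play is at an accepting node or within one step
    -- of a lower layer, and the lowest layer is empty.
    visits : ∀ {U} (L : Layered U) → Consistent L → ∀ i → π i ∈ U → ∃[ j ] i ≤ j × π j ∈ F
    visits base _ i ∈⊥ = contradiction ∈⊥ ∉⊥
    visits (layer L U⊆U′ enter) con i ∈U′ with advance L U⊆U′ enter con i ∈U′
    ... | inj₁ ∈U = visits L (consistent-below L U⊆U′ enter con) i ∈U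
    ... | inj₂ (inj₂ (∈F , _)) = i , ≤-refl , ∈F
    ... | inj₂ (inj₁ ∈U) with j , 1+i≤j , ∈F ← visits L (consistent-below L U⊆U′ enter con) (suc i) ∈U =
      j , ≤-trans (n≤1+n i) 1+i≤j , ∈F

  layeredStrategy-wins : ∀ {U} (L : Layered U) {v} → v ∈ U → WinsFrom G (forgetful (layeredStrategy L)) v
  layeredStrategy-wins {U} L v∈U π (π₀≡v , edges) compatible i =
    visits edges L consistent i (in-U i)
    where
    consistent : Consistent edges L
    consistent i _ = compatible i
    in-U : ∀ i → π i ∈ U
    in-U zero = subst (_∈ U) (sym π₀≡v) v∈U
    in-U (suc i) = stays edges L consistent i (in-U i)

  -- Bounding the number of rounds

  -- In round i the accepting nodes with d v ≤ i are safe, as an edge leaving F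
  -- leads to a smaller value of d, and the layers force the others into them.
  module _ (d : V → ℕ)
    (d-mono : ∀ {u v} → u ⟶ v → d v ≤ d u)
    (d-strict : ∀ {u v} → u ⟶ v → u ∈ F → v ∉ F → d v < d u) where

    approx-complete : ∀ N i {v} → v ∈ approx N → d v < i → v ∈ approx i
    approx-complete N (suc i) v∈ d< = collect (Layered-approx N) id v∈ d<
      where
      W = approx i
      accepting : ∀ {v} → v ∈ approx N → d v < suc i → v ∈ F → v ∈ safe W
      -- Induction along the iteration from `⊤`: `approx N` is forced into itself, and a successor
      -- in it is either accepting again or, having left `F` with a smaller `d`, already in
      -- `approx i`.
      accepting = proj₂ (iterates-induction
        (λ Z → W ⊆ Z × (∀ {v} → v ∈ approx N → d v < suc i → v ∈ F → v ∈ Z))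
        extend (safe-iterates W) (⊆-max W , λ _ _ _ → ∈⊤))
        where
        extend : ∀ {Z} → W ⊆ Z × (∀ {v} → v ∈ approx N → d v < suc i → v ∈ F → v ∈ Z) →
          W ⊆ body F W Z × (∀ {v} → v ∈ approx N → d v < suc i → v ∈ F → v ∈ body F W Z)
        extend {Z} (W⊆Z , hyp) = (λ v∈W → from (body⇔ {F} {W} {Z}) (inj₁ v∈W)) , λ {v} v∈ d< v∈F →
          from (body⇔ {F} {W} {Z}) (inj₂ (v∈F , CPreₛ-map (successor v∈F d<) (Layered-closed (Layered-approx N) v∈)))
          where
          successor : ∀ {v} → v ∈ F → d v < suc i → ∀ {u} → u ∈ E v → u ∈ approx N → u ∈ Z
          successor v∈F d< {u} u∈E u∈ with u ∈? F
          ... | yes u∈F = hyp u∈ (≤-<-trans (d-mono u∈E) d<) u∈F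
          ... | no u∉F = W⊆Z (approx-complete N i u∈ (<-≤-trans (d-strict u∈E v∈F u∉F) (s≤s⁻¹ d<)))

      collect : ∀ {U} → Layered U → U ⊆ approx N → ∀ {v} → v ∈ U → d v < suc i → v ∈ next W
      collect base _ v∈ _ = contradiction v∈ ∉⊥
      collect (layer L U⊆U′ enter) U′⊆ v∈ d< with enter v∈
      ... | inj₁ v∈U = collect L (U′⊆ ∘ U⊆U′) v∈U d<
      ... | inj₂ (inj₁ (v∈F , _)) = safe⊆next (accepting (U′⊆ v∈) d< v∈F)
      ... | inj₂ (inj₂ v∈C) = ∈-reach (inj₂ (CPreₛ-map
        (λ u∈E u∈U → collect L (U′⊆ ∘ U⊆U′) u∈U (≤-<-trans (d-mono u∈E) d<)) v∈C))

  -- Counterplays of the environment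

  -- The environment can force a visit to ∁ F from v without entering W.
  data Escape (W : Subset size) : V → Set where
    now         : ∀ {v} → v ∉ W → v ∉ F → Escape W v
    system      : ∀ {v} → v ∉ W → v ∈ Vₛ → (∀ {u} → u ∈ E v → Escape W u) → Escape W v
    environment : ∀ {v u} → v ∉ W → v ∉ Vₛ → u ∈ E v → Escape W u → Escape W v

  module _ {W : Subset size} (fixed : next W ≡ W) where

    -- A `reach` set absorbs its forced predecessors. Hence the environment can always remain
    -- outside `W`, also after a visit to `∁ F`.
    CPreₛ⊆W : CPreₛ W ⊆ W
    CPreₛ⊆W {v} v∈C = subst (v ∈_) fixed
      (∈-reach (inj₂ (CPreₛ-mono (λ {u} → subst (u ∈_) (sym fixed)) v∈C)))

    -- As `safe W ⊆ W`, a node outside `W` is removed at some stage of the safety iteration. It is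
    -- then in `∁ F`, or the environment can ensure a step to a node removed earlier, which makes
    -- the escape well-founded.
    ∉W⇒Escape : ∀ {v} → v ∉ W → Escape W v
    ∉W⇒Escape v∉W = proj₂ (iterates-induction (λ Z → W ⊆ Z × (∀ {v} → v ∉ Z → Escape W v))
      (λ { {Z} (W⊆Z , escape) → (λ v∈W → from (body⇔ {F} {W} {Z}) (inj₁ v∈W)) , extend Z W⊆Z escape })
      (safe-iterates W) (⊆-max W , λ v∉⊤ → contradiction ∈⊤ v∉⊤))
      λ v∈safe → v∉W (subst (_ ∈_) fixed (safe⊆next v∈safe))
      where
      extend : ∀ Z → W ⊆ Z → (∀ {v} → v ∉ Z → Escape W v) → ∀ {v} → v ∉ body F W Z → Escape W v
      extend Z W⊆Z escape {v} v∉body = go (v ∈? F) (v ∈? Vₛ)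
        where
        v∉ : v ∉ W
        v∉ v∈W = v∉body (from (body⇔ {F} {W} {Z}) (inj₁ v∈W))
        go : Dec (v ∈ F) → Dec (v ∈ Vₛ) → Escape W v
        go (no v∉F) _ = now v∉ v∉F
        go (yes v∈F) s? with v∉C ← (λ v∈C → v∉body (from (body⇔ {F} {W} {Z}) (inj₂ (v∈F , v∈C)))) | s?
        ... | yes s = system v∉ s (λ u∈E → escape (∉CPreₛ-system v∉C s u∈E))
        ... | no ¬s with u , u∈E , u∉Z ← ∉CPreₛ-environment v∉C ¬s =
          environment v∉ ¬s u∈E (escape u∉Z)

    module _ (σ : Strategy G) where
      open Strategy σ renaming (move to σ-move; legal to σ-legal)

      -- The past is stored because `σ` may depend on it, the escape because it is the environment's
      -- remaining plan for reaching `∁ F`.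
      record State : Set where
        constructor state
        field
          past    : List V
          current : V
          escape  : Escape W current

      open State

      successor : State → State
      successor (state h v (system _ s escape)) =
        state (h ∷ʳ v) (σ-move h v s) (escape (σ-legal h v s))
      successor (state h v (environment {u = u} _ _ _ e)) = state (h ∷ʳ v) u e
      -- The plan is fulfilled, so a fresh escape starts at a successor outside `W`.
      successor (state h v (now v∉W _)) with v ∈? Vₛ
      ... | yes s = state (h ∷ʳ v) (σ-move h v s)
        (∉W⇒Escape (∉CPreₛ-system (v∉W ∘ CPreₛ⊆W) s (σ-legal h v s)))
      ... | no ¬s with u , _ , u∉W ← ∉CPreₛ-environment (v∉W ∘ CPreₛ⊆W) ¬s =
        state (h ∷ʳ v) u (∉W⇒Escape u∉W)

      successor-past : ∀ s → past (successor s) ≡ past s ∷ʳ current s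
      successor-past (state h v (system _ _ _)) = refl
      successor-past (state h v (environment _ _ _ _)) = refl
      successor-past (state h v (now v∉W _)) with v ∈? Vₛ
      ... | yes _ = refl
      ... | no _ = refl

      successor-edge : ∀ s → current s ⟶ current (successor s)
      successor-edge (state h v (system _ s _)) = σ-legal h v s
      successor-edge (state h v (environment _ _ u∈E _)) = u∈E
      successor-edge (state h v (now v∉W _)) with v ∈? Vₛ
      ... | yes s = σ-legal h v s
      ... | no ¬s = proj₁ (proj₂ (∉CPreₛ-environment (v∉W ∘ CPreₛ⊆W) ¬s))

      successor-move : ∀ st (s : current st ∈ Vₛ) →
        current (successor st) ≡ σ-move (past st) (current st) s
      -- `σ` takes a proof of `v ∈ Vₛ` as argument; any two such proofs are equal.
      successor-move (state h v (system _ s _)) s′ = cong (σ-move h v) ([]=-irrelevant s s′)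
      successor-move (state h v (environment _ ¬s _ _)) s = contradiction s ¬s
      successor-move (state h v (now _ _)) s′ with v ∈? Vₛ
      ... | yes s = cong (σ-move h v) ([]=-irrelevant s s′)
      ... | no ¬s = contradiction s′ ¬s

      module _ {v₀ : V} (v₀∉W : v₀ ∉ W) where

        states : ℕ → State
        states zero = state [] v₀ (∉W⇒Escape v₀∉W)
        states (suc i) = successor (states i)

        counterplay : ℕ → V
        counterplay = current ∘ states

        counterplay-edges : ∀ i → counterplay i ⟶ counterplay (suc i)
        counterplay-edges i = successor-edge (states i)

        past-counterplay : ∀ i → past (states i) ≡ applyUpTo counterplay i
        past-counterplay zero = refl
        past-counterplay (suc i) = trans (successor-past (states i))
          (trans (cong (_∷ʳ counterplay i) (past-counterplay i)) (applyUpTo-∷ʳ counterplay i))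

        counterplay-compatible : Compatible G σ counterplay
        counterplay-compatible i s = trans (successor-move (states i) s)
          (cong (λ h → σ-move h (counterplay i) s) (past-counterplay i))

        counterplay-leaves-F : ∀ i → ∃[ j ] i ≤ j × counterplay j ∉ F
        counterplay-leaves-F i = go i (states i .escape) refl
          where
          -- Generalising the escape, with an equation for the state, makes the recursion
          -- structural.
          go : ∀ i {h v} (e : Escape W v) → states i ≡ state h v e → ∃[ j ] i ≤ j × counterplay j ∉ F
          go i (now _ v∉F) eq = i , ≤-refl , subst (_∉ F) (sym (cong current eq)) v∉F
          go i {h} {v} (system _ s escape) eq
            with j , 1+i≤j , ∉F ← go (suc i) (escape (σ-legal h v s)) (cong successor eq) =
            j , ≤-trans (n≤1+n i) 1+i≤j , ∉F
          go i (environment _ _ _ e) eq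
            with j , 1+i≤j , ∉F ← go (suc i) e (cong successor eq) =
            j , ≤-trans (n≤1+n i) 1+i≤j , ∉F

  -- Consequences of weakness: completeness and ranks

  module _ (F-invariant : ∀ {u v} → Star _⟶_ u v → Star _⟶_ v u → u ∈ F → v ∈ F) where

    play-path : ∀ {π : ℕ → V} → (∀ i → π i ⟶ π (suc i)) → ∀ {i j} → i ≤′ j → Star _⟶_ (π i) (π j)
    play-path edges ≤′-refl = ε
    play-path edges (≤′-step i≤j) = play-path edges i≤j ◅◅ (edges _ ◅ ε)

    -- Of size + 1 visits to F separated by visits to ∁ F, two are to the
    -- same node, which is therefore on a cycle through both F and ∁ F.
    no-alternating-play : ∀ {π : ℕ → V} → (∀ i → π i ⟶ π (suc i)) →
      (∀ i → ∃[ j ] i ≤ j × π j ∈ F) → ¬ (∀ i → ∃[ j ] i ≤ j × π j ∉ F)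
    no-alternating-play {π} edges in-F out-F =
      let a , b , a<b , eq = Fin.pigeonhole (n<1+n size) (π ∘ visit ∘ Fin.toℕ)
          exit-a = out-F (visit (Fin.toℕ a))
      in proj₂ (proj₂ exit-a) (F-invariant
        (play-path {π} edges (≤⇒≤′ (proj₁ (proj₂ exit-a))))
        (subst (Star _⟶_ _) (sym eq) (play-path {π} edges (≤⇒≤′ (exit≤visit a<b))))
        (visit∈F (Fin.toℕ a)))
      where
      visit : ℕ → ℕ
      visit zero = proj₁ (in-F 0)
      visit (suc k) = proj₁ (in-F (proj₁ (out-F (visit k))))
      visit∈F : ∀ k → π (visit k) ∈ F
      visit∈F zero = proj₂ (proj₂ (in-F 0))
      visit∈F (suc k) = proj₂ (proj₂ (in-F (proj₁ (out-F (visit k)))))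
      exit≤next : ∀ k → proj₁ (out-F (visit k)) ≤ visit (suc k)
      exit≤next k = proj₁ (proj₂ (in-F (proj₁ (out-F (visit k)))))
      visit-mono : ∀ {k m} → k ≤′ m → visit k ≤ visit m
      visit-mono ≤′-refl = ≤-refl
      visit-mono (≤′-step {m} k≤m) =
        ≤-trans (visit-mono k≤m) (≤-trans (proj₁ (proj₂ (out-F (visit m)))) (exit≤next m))
      exit≤visit : ∀ {k m} → k < m → proj₁ (out-F (visit k)) ≤ visit m
      exit≤visit {k} k<m = ≤-trans (exit≤next k) (visit-mono (≤⇒≤′ k<m))

    fixpoint-complete : ∀ {W} → next W ≡ W → ∀ {v} → WonBySystem G v → v ∈ W
    fixpoint-complete {W} fixed {v} (σ , wins) = decidable-stable (v ∈? W) λ v∉W →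
      no-alternating-play (counterplay-edges fixed σ v∉W)
        (wins (counterplay fixed σ v∉W) (refl , counterplay-edges fixed σ v∉W)
          (counterplay-compatible fixed σ v∉W))
        (counterplay-leaves-F fixed σ v∉W)

    module _ (reach? : ∀ u v → Dec (Star _⟶_ u v)) {l} (hasSCCs : HasSCCs _⟶_ l) where

      private
        sccs = proj₁ hasSCCs

      Reaches : V → Pred (Subset size) 0ℓ
      Reaches v S = ∃[ u ] u ∈ S × Star _⟶_ v u

      reaches? : ∀ v → Decidable (Reaches v)
      reaches? v S = Fin.any? (λ u → (u ∈? S) ×-dec reach? v u)

      rank : V → ℕ
      rank v = length (filter (reaches? v) sccs)

      rank≤l : ∀ v → rank v ≤ l
      rank≤l v = subst (rank v ≤_) (proj₁ (proj₂ (proj₂ hasSCCs))) (length-filter (reaches? v) sccs)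

      Reaches-step : ∀ {u v} → u ⟶ v → ∀ {S} → Reaches v S → Reaches u S
      Reaches-step e (w , w∈S , p) = w , w∈S , e ◅ p

      rank-mono : ∀ {u v} → u ⟶ v → rank v ≤ rank u
      rank-mono {u} {v} e = length-mono-≤
        (filter⁺ (reaches? v) (reaches? u) (λ { refl → Reaches-step e }) (⊑-refl {x = sccs}))

      -- The SCC of `u` is counted for `u` but not for `v`: a path from `v` into it would make `u`
      -- and `v` mutually reachable, contrary to `F-invariant`.
      rank-strict : ∀ {u v} → u ⟶ v → u ∈ F → v ∉ F → rank v < rank u
      rank-strict {u} {v} e u∈F v∉F =
        length-filter-< (reaches? v) (reaches? u) (Reaches-step e)
          (from (proj₂ (proj₂ (proj₂ hasSCCs)) _) (scc-isSCC reach? u))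
          (u , from (∈-scc reach?) (ε , ε) , ε)
          λ { (w , w∈ , p) → v∉F (F-invariant (e ◅ ε) (p ◅◅ proj₂ (to (∈-scc reach?) w∈)) u∈F) }

    -- Ranks are at most `l` and `approx-complete` asks for a strict bound, hence `suc l`. Equality
    -- of subsets is decidable, so reachability may be decided under a double negation.
    approx-stationary : ∀ {l} → HasSCCs _⟶_ l → approx (2+ l) ≡ approx (suc l)
    approx-stationary {l} hasSCCs = decidable-stable (_ ≟ˢ _) (¬¬-map
      (λ reach? → ⊆-antisym
        (λ v∈ → approx-complete (rank reach? hasSCCs) (rank-mono reach? hasSCCs) (rank-strict reach? hasSCCs)
          (2+ l) (suc l) v∈ (s≤s (rank≤l reach? hasSCCs _)))
        ⊆next)
      ¬¬-reachable?)

-- Weakness of the automaton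

module _ (D : DWA) where
  open DWA D

  Fₜ-invariant : ∀ {p q} → Star _⇝_ p q → Star _⇝_ q p → p ∈ Fₜ → q ∈ Fₜ
  Fₜ-invariant {p} {q} p⇝q q⇝p p∈Fₜ = decidable-stable (q ∈? Fₜ) (¬¬-map in-Fₜ ¬¬-reachable?)
    where
    in-Fₜ : (∀ u v → Dec (Star _⇝_ u v)) → q ∈ Fₜ
    in-Fₜ reach? with weak _ (scc-isSCC reach? p)
    ... | inj₁ S⊆Fₜ = S⊆Fₜ (from (∈-scc reach?) (p⇝q , q⇝p))
    ... | inj₂ S∩Fₜ≡∅ = contradiction (p , x∈p∩q⁺ (from (∈-scc reach?) (ε , ε) , p∈Fₜ)) S∩Fₜ≡∅

-- Arithmetic of the bounds

time-bound : ∀ c n k l → 1 ≤ n → k ≤ n → l ≤ n →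
  c * ((2 + l) * (4 + k) + n) ≤ 15 * c * (n + k * l)
time-bound c n k l 1≤n k≤n l≤n = begin
  c * ((2 + l) * (4 + k) + n)                  ≡⟨ cong (c *_) (expand n k l) ⟩
  -- Each of `1`, `k` and `l` is at most `n`, which gives `8 + 2 + 4 = 14` copies of `n`; the
  -- remaining one makes `15`.
  c * (8 * 1 + 2 * k + 4 * l + (n + k * l))    ≤⟨ *-monoʳ-≤ c (+-monoˡ-≤ (n + k * l)
    (+-mono-≤ (+-mono-≤ (*-monoʳ-≤ 8 1≤n) (*-monoʳ-≤ 2 k≤n)) (*-monoʳ-≤ 4 l≤n))) ⟩
  c * (8 * n + 2 * n + 4 * n + (n + k * l))    ≤⟨ *-monoʳ-≤ c (m≤m+n _ (14 * (k * l))) ⟩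
  c * (8 * n + 2 * n + 4 * n + (n + k * l) + 14 * (k * l))  ≡⟨ collect c n (k * l) ⟩
  15 * c * (n + k * l)                         ∎
  where
  open ≤-Reasoning
  expand : ∀ n k l → (2 + l) * (4 + k) + n ≡ 8 * 1 + 2 * k + 4 * l + (n + k * l)
  expand = solve-∀
  collect : ∀ c n m → c * (8 * n + 2 * n + 4 * n + (n + m) + 14 * m) ≡ 15 * c * (n + m)
  collect = solve-∀

quadratic-bound : ∀ n k l → 1 ≤ n → k ≤ n → l ≤ n → n + k * l ≤ 2 * n ^ 2
quadratic-bound n k l 1≤n k≤n l≤n = begin
  n + k * l      ≤⟨ +-mono-≤ (subst (_≤ n * n) (*-identityʳ n) (*-monoʳ-≤ n 1≤n)) (*-mono-≤ k≤n l≤n) ⟩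
  n * n + n * n  ≡⟨ square n ⟩
  2 * n ^ 2      ∎
  where
  open ≤-Reasoning
  square : ∀ n → n * n + n * n ≡ 2 * (n * (n * 1))
  square = solve-∀

-- Application to weak games

module _ (G : WeakGame) where
  open WeakGame G
  open DWA dwa using (ι; _⇝_; ⟨_⟩; component; Edge; choose-x; choose-y; proceed)
  open Induces induced

  -- A witness that the arena is nonempty, as entering the loop and bounding `l` by `size` require.
  initialNode : V
  initialNode = Inverse.from numbering ⟨ ι ⟩

  Edge⇒⇝ : ∀ {a b} → Edge a b → Star _⇝_ (component a) (component b)
  Edge⇒⇝ (choose-x _) = ε
  Edge⇒⇝ (choose-y _) = ε
  Edge⇒⇝ proceed = (_ , refl) ◅ ε

  -- Choosing `x` or `y` keeps the automaton state, so arena paths project to automaton paths, and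
  -- `F` inherits the invariance of `Fₜ`.
  ⟶*⇒⇝* : ∀ {u v} → Star _⟶_ u v → Star _⇝_ (component (node u)) (component (node v))
  ⟶*⇒⇝* = kleisliStar (component ∘ node) (λ e → Edge⇒⇝ (to (edges _ _) e))

  F-invariant : ∀ {u v} → Star _⟶_ u v → Star _⟶_ v u → u ∈ F → v ∈ F
  F-invariant {u} {v} p q u∈F = from (accepting v)
    (Fₜ-invariant dwa (⟶*⇒⇝* p) (⟶*⇒⇝* q) (to (accepting u) u∈F))

  1≤size : 1 ≤ size
  1≤size = ≤-trans (s≤s z≤n) (Fin.toℕ<n initialNode)

  module _ {l} (hasSCCs : HasSCCs _⟶_ l) where

    l≤size : l ≤ size
    l≤size = #SCCs≤n initialNode hasSCCs

    algorithm-correct : ∀ κ (let open SymbolicAlgorithm game κ) → ∃[ W ] ∃[ t ]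
      SolveSafeReach W t
      × t ≤ 15 * (2 + κ) * (size + ∣ F ∣ * l)
      × (∀ v → v ∈ W ⇔ WonBySystem game v)
      × (∃[ σ ] ∀ v → v ∈ W → WinsFrom game (forgetful σ) v)
    algorithm-correct κ =
      let open Game game κ
          m , t , run , fixed , t≤ =
            -- Stationarity at index `suc l` allows `2 + l` rounds, the first factor in
            -- `time-bound`.
            algorithm-terminates initialNode (suc l) (approx-stationary F-invariant hasSCCs)
          σ = layeredStrategy (Layered-approx m)
          σ-wins = layeredStrategy-wins (Layered-approx m)
      in approx m , t , run ,
         ≤-trans t≤ (time-bound (2 + κ) size ∣ F ∣ l 1≤size (∣p∣≤n F) l≤size) ,
         (λ v → mk⇔ (λ v∈W → forgetful σ , σ-wins v∈W) (fixpoint-complete F-invariant fixed)) ,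
         σ , λ v → σ-wins

lemma7 : (κ : ℕ) →
    (∃[ C ] ∀ (G : WeakGame) (let open WeakGame G) (let open SymbolicAlgorithm game κ)
    (l : ℕ) → HasSCCs _⟶_ l →
    ∃[ W ] ∃[ t ]
    SolveSafeReach W t
    × t ≤ C * (size + ∣ F ∣ * l)
    × (∀ v → v ∈ W ⇔ WonBySystem game v)
    × (∃[ σ ] ∀ v → v ∈ W → WinsFrom game (forgetful σ) v))
    × (∃[ C ] ∀ (G : WeakGame) (let open WeakGame G)
    (l : ℕ) → HasSCCs _⟶_ l →
    size + ∣ F ∣ * l ≤ C * size ^ 2)
lemma7 κ =
  (15 * (2 + κ) , λ G l hasSCCs → algorithm-correct G hasSCCs κ) ,
  (2 , λ G l hasSCCs →
    quadratic-bound _ ∣ WeakGame.F G ∣ l (1≤size G) (∣p∣≤n (WeakGame.F G)) (l≤size G hasSCCs))
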